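{- Let $K$ be a simplicial complex and let $\overrightarrow{W}$ be a Morse sequence on $K$. Then there exists exactly one reference map for $\overrightarrow{W}$ and exactly one coreference map for $\overrightarrow{W}$.
   Context: A simplicial complex $K$ is a finite collection of non-empty finite sets such that every non-empty subset of a member of $K$ is also in $K$; its members are called simplices (or faces), $\dim\sigma=|\sigma|-1$, $K^{(p)}$ denotes the set of $p$-dimensional simplices, and a facet is a simplex maximal for inclusion. A pair $(\sigma,\tau)$ of simplices of $K$ with $\sigma\subsetneq\tau$ is a free pair for $K$ if $\tau$ is the only simplex of $K$ other than $\sigma$ that contains $\sigma$ (so $\tau$ is a facet and $\dim\tau=\dim\sigma+1$); then $K$ is an elementary expansion of $K\setminus\{\sigma,\tau\}$. If $\nu$ is a facet of $K$, then $K$ is an elementary filling of $K\setminus\{\nu\}$. A Morse sequence on $K$ is a sequence $\overrightarrow{W}=\langle \emptyset=K_0,K_1,\dots,K_k=K\rangle$ of simplicial complexes such that each $K_i$ is an elementary expansion or an elementary filling of $K_{i-1}$. If $K_i=K_{i-1}\cup\{\nu\}$ is a filling, $\nu$ is called critical; if $K_i=K_{i-1}\cup\{\sigma,\tau\}$ is an expansion with $\sigma\subset\tau$, then $(\sigma,\tau)$ is a regular pair, $\sigma$ is lower regular and $\tau$ is upper regular. Let $\widehat{W}$ be the set of critical simplices. Chains mod 2: $K[p]$ is the set of all subsets of $K^{(p)}$, a vector space over $\mathbb{Z}_2$ with symmetric difference as addition, the empty chain written $0$; $\widehat{W}[p]=\{c\in K[p]: c\subseteq \widehat W\}$. For $\sigma\in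 K^{(p)}$, $\partial(\sigma)=\{\tau\in K^{(p-1)}:\tau\subset\sigma\}$ and $\delta(\sigma)=\{\tau\in K^{(p+1)}:\sigma\subset\tau\}$. A frame on $\overrightarrow{W}$ is a map $\Upsilon$ assigning to each $\nu\in K^{(p)}$ an element $\Upsilon(\nu)\in\widehat W[p]$; it is extended linearly to chains by $\Upsilon(c)=\sum_{\nu\in c}\Upsilon(\nu)$ (sum mod 2). A frame $\curlywedge$ is a reference map for $\overrightarrow{W}$ if $\curlywedge(\nu)=\{\nu\}$ for every critical $\nu$ and, for every upper regular $\tau$, $\curlywedge(\tau)=0$ and $\curlywedge(\partial(\tau))=0$. A frame $\curlyvee$ is a coreference map for $\overrightarrow{W}$ if $\curlyvee(\nu)=\{\nu\}$ for every critical $\nu$ and, for every lower regular $\sigma$, $\curlyvee(\sigma)=0$ and $\curlyvee(\delta(\sigma))=0$. -}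

module Defs where

open import Data.Bool.Base using (Bool; true; false; _xor_)
open import Data.Bool.Properties using () renaming (_≟_ to _≟ᵇ_)
open import Data.Fin.Base using (Fin; zero; suc; inject₁; fromℕ)
open import Data.Fin.Subset using (Subset; inside; outside; Nonempty; ∣_∣; _⊆_; _⊂_)
open import Data.Fin.Subset.Properties using (_⊂?_)
open import Data.Integer.Base using (ℤ; +_; 1ℤ; _+_; _-_)
open import Data.Integer.Properties using () renaming (_≟_ to _≟ᶻ_)
open import Data.List.Base using (List; []; _∷_; _++_; map; mapMaybe; filterᵇ; foldr)
open import Data.Maybe.Base using (Maybe; just; nothing)
open import Data.Nat.Base using (ℕ; zero; suc)
open import Data.Product using (∃; ∃₂; _×_; _,_)
open import Data.Sum.Base using (_⊎_)
open import Data.Vec.Base using ([]; _∷_)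
open import Data.Vec.Properties using (≡-dec)
open import Level using (0ℓ)
open import Relation.Binary.Definitions using (DecidableEquality)
open import Relation.Binary.PropositionalEquality using (_≡_; _≢_; _≗_)
open import Relation.Nullary.Decidable using (does; yes; no; _×-dec_)
open import Relation.Unary using (Pred; Decidable; ∅; ｛_｝; _∈_; _∪_; _∖_; _≐_)

_≟ˢ_ : ∀ {n} → DecidableEquality (Subset n)
_≟ˢ_ = ≡-dec _≟ᵇ_

-- A finite complex has finitely many vertices; they are labelled by Fin n, so
-- that a finite collection of simplices is a decidable predicate on Subset n.
record SimplicialComplex (n : ℕ) : Set₁ where
  field
    faces    : Pred (Subset n) 0ℓ
    _∈?faces : Decidable faces
    nonempty : ∀ {σ} → σ ∈ faces → Nonempty σ
    closed   : ∀ {σ τ} → τ ∈ faces → σ ⊆ τ → Nonempty σ → σ ∈ faces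

open SimplicialComplex public using (faces)

dim : ∀ {n} → Subset n → ℤ
dim σ = + ∣ σ ∣ - 1ℤ

IsFacet : ∀ {n} → SimplicialComplex n → Subset n → Set
IsFacet K ν = ν ∈ faces K × (∀ {ρ} → ρ ∈ faces K → ν ⊆ ρ → ρ ≡ ν)

IsFreePair : ∀ {n} → SimplicialComplex n → Subset n → Subset n → Set
IsFreePair K σ τ =
  σ ∈ faces K × τ ∈ faces K × σ ⊂ τ ×
  (∀ {ρ} → ρ ∈ faces K → ρ ≢ σ → σ ⊆ ρ → ρ ≡ τ)

-- IsExpansionBy L K σ τ: K is the elementary expansion of L adding σ and τ.
IsExpansionBy : ∀ {n} (L K : SimplicialComplex n) → Subset n → Subset n → Set
IsExpansionBy L K σ τ =
  IsFreePair K σ τ × faces L ≐ (faces K ∖ (｛ σ ｝ ∪ ｛ τ ｝))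

-- IsFillingBy L K ν: K is the elementary filling of L adding ν.
IsFillingBy : ∀ {n} (L K : SimplicialComplex n) → Subset n → Set
IsFillingBy L K ν = IsFacet K ν × faces L ≐ (faces K ∖ ｛ ν ｝)

record MorseSequence {n} (K : SimplicialComplex n) : Set₁ where
  field
    length  : ℕ
    complex : Fin (suc length) → SimplicialComplex n
    start   : faces (complex zero) ≐ ∅
    end     : faces (complex (fromℕ length)) ≐ faces K
    step    : (i : Fin length) →
              ∃₂ (IsExpansionBy (complex (inject₁ i)) (complex (suc i))) ⊎
              ∃ (IsFillingBy (complex (inject₁ i)) (complex (suc i)))

module _ {n} {K : SimplicialComplex n} (W : MorseSequence K) where
  open MorseSequence W

  IsCritical : Subset n → Set
  IsCritical ν = ∃ λ i → IsFillingBy (complex (inject₁ i)) (complex (suc i)) ν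

  IsRegularPair : Subset n → Subset n → Set
  IsRegularPair σ τ = ∃ λ i → IsExpansionBy (complex (inject₁ i)) (complex (suc i)) σ τ

  IsLowerRegular : Subset n → Set
  IsLowerRegular σ = ∃ λ τ → IsRegularPair σ τ

  IsUpperRegular : Subset n → Set
  IsUpperRegular τ = ∃ λ σ → IsRegularPair σ τ

-- The set K⁽ᵖ⁾. The proofs are irrelevant, so that a simplex is determined by
-- its vertices.
record Simplex {n} (K : SimplicialComplex n) (p : ℤ) : Set where
  constructor simplex
  field
    vertices : Subset n
    .isFace  : vertices ∈ faces K
    .hasDim  : dim vertices ≡ p

open Simplex public using (vertices)

-- Every subset of Fin n is listed exactly once.
subsets : ∀ n → List (Subset n)
subsets zero    = [] ∷ []
subsets (suc n) = map (outside ∷_) (subsets n) ++ map (inside ∷_) (subsets n)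

-- Every element of K⁽ᵖ⁾ is listed exactly once.
simplices : ∀ {n} (K : SimplicialComplex n) (p : ℤ) → List (Simplex K p)
simplices {n} K p = mapMaybe toSimplex (subsets n)
  where
  open SimplicialComplex K using (_∈?faces)

  toSimplex : Subset n → Maybe (Simplex K p)
  toSimplex σ with (σ ∈?faces) ×-dec (dim σ ≟ᶻ p)
  ... | yes (σ∈K , dimσ≡p) = just (simplex σ σ∈K dimσ≡p)
  ... | no _               = nothing

-- K[p]: a subset of K⁽ᵖ⁾ is given by its characteristic function; chains are
-- compared by pointwise equality _≗_.
Chain : ∀ {n} → SimplicialComplex n → ℤ → Set
Chain K p = Simplex K p → Bool

module _ {n} {K : SimplicialComplex n} where

  0ᶜ : ∀ {p} → Chain K p
  0ᶜ _ = false

  infixl 6 _⊕_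
  _⊕_ : ∀ {p} → Chain K p → Chain K p → Chain K p
  (c ⊕ d) σ = c σ xor d σ

  singleton : ∀ {p} → Simplex K p → Chain K p
  singleton ν σ = does (vertices σ ≟ˢ vertices ν)

  ∂ : ∀ {p} → Simplex K p → Chain K (p - 1ℤ)
  ∂ σ τ = does (vertices τ ⊂? vertices σ)

  δ : ∀ {p} → Simplex K p → Chain K (p + 1ℤ)
  δ σ τ = does (vertices σ ⊂? vertices τ)

-- Ŵ[p]
record CriticalChain {n} {K : SimplicialComplex n} (W : MorseSequence K) (p : ℤ) : Set where
  field
    chain    : Chain K p
    critical : ∀ σ → chain σ ≡ true → IsCritical W (vertices σ)

record Frame {n} {K : SimplicialComplex n} (W : MorseSequence K) : Set where
  field
    value : ∀ {p} → Simplex K p → CriticalChain W p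

  onSimplex : ∀ {p} → Simplex K p → Chain K p
  onSimplex ν = CriticalChain.chain (value ν)

  onChain : ∀ {p} → Chain K p → Chain K p
  onChain {p} c = foldr _⊕_ 0ᶜ (map onSimplex (filterᵇ c (simplices K p)))

module _ {n} {K : SimplicialComplex n} {W : MorseSequence K} where

  infix 4 _≈ᶠ_
  _≈ᶠ_ : Frame W → Frame W → Set
  Υ ≈ᶠ Υ′ = ∀ {p} (ν : Simplex K p) → Frame.onSimplex Υ ν ≗ Frame.onSimplex Υ′ ν

module _ {n} {K : SimplicialComplex n} (W : MorseSequence K) where

  record IsReferenceMap (Υ : Frame W) : Set where
    open Frame Υ
    field
      onCritical : ∀ {p} (ν : Simplex K p) → IsCritical W (vertices ν) →
                   onSimplex ν ≗ singleton ν
      onUpper    : ∀ {p} (τ : Simplex K p) → IsUpperRegular W (vertices τ) →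
                   onSimplex τ ≗ 0ᶜ
      onBoundary : ∀ {p} (τ : Simplex K p) → IsUpperRegular W (vertices τ) →
                   onChain (∂ τ) ≗ 0ᶜ

  record IsCoreferenceMap (Υ : Frame W) : Set where
    open Frame Υ
    field
      onCritical   : ∀ {p} (ν : Simplex K p) → IsCritical W (vertices ν) →
                     onSimplex ν ≗ singleton ν
      onLower      : ∀ {p} (σ : Simplex K p) → IsLowerRegular W (vertices σ) →
                     onSimplex σ ≗ 0ᶜ
      onCoboundary : ∀ {p} (σ : Simplex K p) → IsLowerRegular W (vertices σ) →
                     onChain (δ σ) ≗ 0ᶜ

{-# OPTIONS --safe #-}

-- A reference map must satisfy, for every regular pair (σ , τ),
--   ⋏(σ) = Σ { ⋏(ν) ∣ ν ∈ ∂ τ , ν ≠ σ },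
-- and each ν on the right entered the sequence strictly before σ, because
-- closure puts ν in the complex that σ and τ complete. Prescribed on the
-- critical and the upper regular simplices, ⋏ is thus determined recursively
-- along the sequence. Dually, a coreference map satisfies
--   ⋎(τ) = Σ { ⋎(ν) ∣ ν ∈ δ σ , ν ≠ τ },
-- and each ν on the right enters strictly after τ, because (σ , τ) is free when
-- it is added; the recursion runs backwards. Both are instances of the unique
-- fixed point of an operator that reads only arguments of smaller rank.
module Submission where

open import Defs
open import Data.Bool.Base using (Bool; true; false; not; _∧_; _xor_)
open import Data.Bool.Properties using (xor-assoc; xor-comm; xor-same)
open import Data.Fin.Base as Fin using (Fin; zero; suc; inject₁; fromℕ; toℕ)
open import Data.Fin.Induction using (<-weakInduction; <-weakInduction-startingFrom)
open import Data.Fin.Properties using (≤fromℕ; toℕ-inject₁; toℕ<n; <-cmp)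
open import Data.Fin.Subset using (Subset; inside; outside; ∣_∣; ⁅_⁆; _⊆_; _⊂_) renaming (_∈_ to _∈ˢ_; _∉_ to _∉ˢ_; _∪_ to _∪ˢ_)
open import Data.Fin.Subset.Properties using (_⊂?_; p⊆p∪q; q⊆p∪q; x∈p∪q⁻; x∈⁅y⁆⇒x≡y; x∈⁅x⁆; ∪-identityʳ; ⊂-irref; ⊂-asymmetric)
open import Data.Integer.Base using (ℤ; +_; -_; 1ℤ; _+_; _-_)
open import Data.Integer.Properties using (+-assoc; +-identityʳ) renaming (_≟_ to _≟ᶻ_)
open import Data.List.Base using (List; []; _∷_; map; mapMaybe; filterᵇ; foldr)
open import Data.List.Membership.Propositional using () renaming (_∈_ to _∈ˡ_)
open import Data.List.Membership.Propositional.Properties using (∈-++⁺ˡ; ∈-++⁺ʳ; ∈-map⁺; ∈-map⁻)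
open import Data.List.Relation.Unary.All as All using (All; []; _∷_)
open import Data.List.Relation.Unary.AllPairs using ([]; _∷_)
open import Data.List.Relation.Unary.Any using (here; there)
open import Data.List.Relation.Unary.Unique.Propositional using (Unique)
open import Data.List.Relation.Unary.Unique.Propositional.Properties using (map⁺; ++⁺)
open import Data.Maybe.Base using (Maybe; just; nothing)
open import Data.Nat.Base using (ℕ; zero; suc; _≤_; _<_; _∸_; s≤s; s≤s⁻¹)
import Data.Nat.Properties as ℕ
open import Data.Product using (∃; ∃!; _×_; _,_; proj₁; proj₂)
open import Data.Sum.Base using (_⊎_; inj₁; inj₂; map₂; swap)
open import Data.Vec.Base using ([]; _∷_) renaming (here to hereᵛ; there to thereᵛ)
open import Data.Vec.Properties using (∷-injectiveʳ)
open import Function.Base using (_∘_)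
open import Relation.Binary.Definitions using (tri<; tri≈; tri>)
open import Relation.Binary.PropositionalEquality using (_≡_; _≢_; _≗_; refl; sym; trans; cong; cong₂; subst; module ≡-Reasoning)
open import Relation.Nullary.Decidable using (Dec; does; yes; no; recompute; dec-true; _×-dec_)
open import Relation.Nullary.Negation using (¬_; contradiction)
open import Relation.Unary using (_∈_; _∉_)

-- Operators reading only arguments of smaller rank

module Contraction {A B : Set} (b₀ : B) (rank : A → ℕ) (Φ : (A → B) → A → B)
  (contractive : ∀ {g h} x → (∀ y → rank y < rank x → g y ≡ h y) → Φ g x ≡ Φ h x)
  where

  iterate : ℕ → A → B
  iterate zero    _ = b₀
  iterate (suc k)   = Φ (iterate k)

  -- Each application of `Φ` settles the values at one further rank, so `b₀` has lost all influence
  -- at `x` once more than `rank x` iterations are made.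
  iterate-stable : ∀ {j k} x → rank x < j → rank x < k → iterate j x ≡ iterate k x
  iterate-stable {suc j} {suc k} x x<j x<k = contractive x λ y y<x →
    iterate-stable y (ℕ.<-≤-trans y<x (s≤s⁻¹ x<j)) (ℕ.<-≤-trans y<x (s≤s⁻¹ x<k))

  -- The iteration count varies with the argument: `suc (rank x)` is the first count covered by
  -- `iterate-stable`, and every argument that `Φ` reads at `x` is settled one count earlier.
  fix : A → B
  fix x = iterate (suc (rank x)) x

  fix-eq : ∀ x → fix x ≡ Φ fix x
  fix-eq x = contractive x λ y y<x → iterate-stable y y<x (ℕ.n<1+n (rank y))

  fix-unique : ∀ {g h} → (∀ x → g x ≡ Φ g x) → (∀ x → h x ≡ Φ h x) → g ≗ h
  fix-unique {g} {h} g-eq h-eq x = below (suc (rank x)) x (ℕ.n<1+n (rank x))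
    where
    below : ∀ k x → rank x < k → g x ≡ h x
    below (suc k) x x<k = trans (g-eq x) (trans
      (contractive x λ y y<x → below k y (ℕ.<-≤-trans y<x (s≤s⁻¹ x<k)))
      (sym (h-eq x)))

-- Sums mod 2

xor-false⇒≡ : ∀ x y → x xor y ≡ false → x ≡ y
xor-false⇒≡ false false _ = refl
xor-false⇒≡ true  true  _ = refl

module _ {A : Set} where

  ⨁ : (A → Bool) → List A → Bool
  ⨁ f []       = false
  ⨁ f (x ∷ xs) = f x xor ⨁ f xs

  ⨁-cong : ∀ {f g} → f ≗ g → ⨁ f ≗ ⨁ g
  ⨁-cong f≗g []       = refl
  ⨁-cong f≗g (x ∷ xs) = cong₂ _xor_ (f≗g x) (⨁-cong f≗g xs)

  ⨁-cong-All : ∀ {f g xs} → All (λ x → f x ≡ g x) xs → ⨁ f xs ≡ ⨁ g xs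
  ⨁-cong-All []         = refl
  ⨁-cong-All (eq ∷ eqs) = cong₂ _xor_ eq (⨁-cong-All eqs)

  ⨁-true : ∀ f xs → ⨁ f xs ≡ true → ∃ λ x → f x ≡ true
  ⨁-true f (x ∷ xs) eq with f x in fx
  ... | true  = x , fx
  ... | false = ⨁-true f xs eq

  -- Here `g` plays the role of `f` with its term at `s` struck out. Uniqueness ensures that `s`
  -- occurs once, so beyond that occurrence both sums agree; terms before it are moved past `f s` by
  -- commutativity.
  ⨁-isolate : ∀ {f g s xs} → (∀ {x} → s ≢ x → f x ≡ g x) → g s ≡ false →
              Unique xs → s ∈ˡ xs → ⨁ f xs ≡ f s xor ⨁ g xs
  ⨁-isolate {f} {g} {s} {xs = x ∷ xs} f≡g gs≡false (x∉xs ∷ _) (here refl) =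
    cong (f s xor_) (trans (⨁-cong-All (All.map f≡g x∉xs))
                           (cong (_xor ⨁ g xs) (sym gs≡false)))
  ⨁-isolate {f} {g} {s} {xs = x ∷ xs} f≡g gs≡false (x∉xs ∷ xs!) (there s∈xs) = begin
    f x xor ⨁ f xs           ≡⟨ cong₂ _xor_ (f≡g (All.lookup x∉xs s∈xs ∘ sym))
                                             (⨁-isolate f≡g gs≡false xs! s∈xs) ⟩
    g x xor (f s xor ⨁ g xs) ≡⟨ xor-assoc (g x) (f s) _ ⟨
    (g x xor f s) xor ⨁ g xs ≡⟨ cong (_xor ⨁ g xs) (xor-comm (g x) (f s)) ⟩
    (f s xor g x) xor ⨁ g xs ≡⟨ xor-assoc (f s) (g x) _ ⟩
    f s xor (g x xor ⨁ g xs) ∎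
    where open ≡-Reasoning

-- Enumeration of the simplices

subsets-complete : ∀ {n} (σ : Subset n) → σ ∈ˡ subsets n
subsets-complete []            = here refl
subsets-complete (outside ∷ σ) = ∈-++⁺ˡ (∈-map⁺ _ (subsets-complete σ))
subsets-complete (inside  ∷ σ) = ∈-++⁺ʳ _ (∈-map⁺ _ (subsets-complete σ))

subsets-unique : ∀ n → Unique (subsets n)
subsets-unique zero    = [] ∷ []
subsets-unique (suc n) =
  ++⁺ (map⁺ ∷-injectiveʳ (subsets-unique n)) (map⁺ ∷-injectiveʳ (subsets-unique n)) disjoint
  where
  disjoint : ∀ {σ} → ¬ (σ ∈ˡ map (outside ∷_) (subsets n) × σ ∈ˡ map (inside ∷_) (subsets n))
  disjoint (σ∈out , σ∈in) with ∈-map⁻ _ σ∈out | ∈-map⁻ _ σ∈in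
  ... | _ , _ , refl | _ , _ , ()

module _ {A B : Set} {f : A → Maybe B} where

  ∈-mapMaybe⁺ : ∀ {x y xs} → x ∈ˡ xs → f x ≡ just y → y ∈ˡ mapMaybe f xs
  ∈-mapMaybe⁺ {x} (here refl) fx≡ with f x | fx≡
  ... | just _ | refl = here refl
  ∈-mapMaybe⁺ {xs = z ∷ _} (there x∈xs) fx≡ with f z
  ... | nothing = ∈-mapMaybe⁺ x∈xs fx≡
  ... | just _  = there (∈-mapMaybe⁺ x∈xs fx≡)

  module _ {v : B → A} (v-f : ∀ {x y} → f x ≡ just y → v y ≡ x) where

    All-mapMaybe : ∀ {P : A → Set} {xs} → All P xs → All (P ∘ v) (mapMaybe f xs)
    All-mapMaybe [] = []
    All-mapMaybe {P} {x ∷ xs} (px ∷ pxs) with f x in fx≡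
    ... | nothing = All-mapMaybe pxs
    ... | just y  = subst P (sym (v-f fx≡)) px ∷ All-mapMaybe pxs

    -- Since `v` recovers the argument from the value, `f` is injective where it is defined, and a
    -- repeated output would come from a repeated input.
    Unique-mapMaybe : ∀ {xs} → Unique xs → Unique (mapMaybe f xs)
    Unique-mapMaybe [] = []
    Unique-mapMaybe {x ∷ xs} (x∉xs ∷ xs!) with f x in fx≡
    ... | nothing = Unique-mapMaybe xs!
    ... | just y  = All.map (λ x≢vz y≡z → x≢vz (trans (sym (v-f fx≡)) (cong v y≡z)))
                            (All-mapMaybe x∉xs)
                  ∷ Unique-mapMaybe xs!

module _ {n} {K : SimplicialComplex n} where
  open SimplicialComplex K using (_∈?faces)

  -- The field is irrelevant, but membership is decidable, so a usable proof can be recomputed.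
  isFace : ∀ {p} (ν : Simplex K p) → vertices ν ∈ faces K
  isFace (simplex σ σ∈K _) = recompute (σ ∈?faces) σ∈K

  hasDim : ∀ {p} (ν : Simplex K p) → dim (vertices ν) ≡ p
  hasDim {p} (simplex σ _ dimσ) = recompute (dim σ ≟ᶻ p) dimσ

  vertices-injective : ∀ {p} {ν κ : Simplex K p} → vertices ν ≡ vertices κ → ν ≡ κ
  vertices-injective refl = refl

module _ {n} (K : SimplicialComplex n) (p : ℤ) where
  open SimplicialComplex K using (_∈?faces)

  -- The function local to the definition of simplices is named by unification.
  simplices-mapMaybe : ∃ λ f → simplices K p ≡ mapMaybe f (subsets n)
  simplices-mapMaybe = _ , refl

  toSimplex : Subset n → Maybe (Simplex K p)
  toSimplex = proj₁ simplices-mapMaybe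

  toSimplex-vertices : ∀ (ν : Simplex K p) → toSimplex (vertices ν) ≡ just ν
  toSimplex-vertices ν with (vertices ν ∈?faces) ×-dec (dim (vertices ν) ≟ᶻ p)
  ... | yes _ = refl
  ... | no ¬p = contradiction (isFace ν , hasDim ν) ¬p

  vertices-toSimplex : ∀ {σ ν} → toSimplex σ ≡ just ν → vertices ν ≡ σ
  vertices-toSimplex {σ} eq with (σ ∈?faces) ×-dec (dim σ ≟ᶻ p)
  vertices-toSimplex refl | yes _ = refl

  simplices-complete : ∀ ν → ν ∈ˡ simplices K p
  simplices-complete ν = ∈-mapMaybe⁺ (subsets-complete (vertices ν)) (toSimplex-vertices ν)

  simplices-unique : Unique (simplices K p)
  simplices-unique = Unique-mapMaybe {f = toSimplex} vertices-toSimplex (subsets-unique n)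

-- Frames determined by an acyclic matching

-- Evaluation at a fixed `κ` turns the linear extension of a frame into a Boolean sum over the whole
-- list, with the chain as coefficients; single terms can then be isolated.
foldr-⊕ : ∀ {n} {K : SimplicialComplex n} {p} {A : Set} (F : A → Chain K p) c xs κ →
          foldr _⊕_ 0ᶜ (map F (filterᵇ c xs)) κ ≡ ⨁ (λ x → c x ∧ F x κ) xs
foldr-⊕ F c []       κ = refl
foldr-⊕ F c (x ∷ xs) κ with c x
... | true  = cong (F x κ xor_) (foldr-⊕ F c xs κ)
... | false = foldr-⊕ F c xs κ

omit : ∀ {n} {K : SimplicialComplex n} {p} → Simplex K p → Chain K p → Chain K p
omit ν c κ = not (singleton ν κ) ∧ c κ

omit-≢ : ∀ {n} {K : SimplicialComplex n} {p} (ν : Simplex K p) c {κ} → ν ≢ κ → c κ ≡ omit ν c κ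
omit-≢ ν c {κ} ν≢κ with vertices κ ≟ˢ vertices ν
... | yes eq = contradiction (vertices-injective (sym eq)) ν≢κ
... | no  _  = refl

omit-self : ∀ {n} {K : SimplicialComplex n} {p} (ν : Simplex K p) c → omit ν c ν ≡ false
omit-self ν c with vertices ν ≟ˢ vertices ν
... | yes _  = refl
... | no neq = contradiction refl neq

-- Mate ν μ relates a simplex ν, whose value is to be solved for, to the simplex
-- μ whose boundary or coboundary link μ gives the equation.
record IsAcyclicMatching {n} {K : SimplicialComplex n} (W : MorseSequence K)
    (Mate : Subset n → Subset n → Set) (link : Subset n → Subset n → Bool) : Set where
  field
    status          : ∀ {ν} → ν ∈ faces K → IsCritical W ν ⊎ ∃ (λ μ → Mate μ ν) ⊎ ∃ (Mate ν)
    critical-source : ∀ {ν μ} → IsCritical W ν → ¬ Mate ν μ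
    critical-target : ∀ {ν μ} → IsCritical W ν → ¬ Mate μ ν
    source-target   : ∀ {ν μ ρ} → Mate ν μ → ¬ Mate ρ ν
    functional      : ∀ {ν μ ρ} → Mate ν μ → Mate ν ρ → μ ≡ ρ
    linked          : ∀ {ν μ} → Mate ν μ → link μ ν ≡ true
    rank            : ∀ {p} → Simplex K p → ℕ
    decreasing      : ∀ {p} (ν κ : Simplex K p) {μ} → Mate (vertices ν) μ →
                      link μ (vertices κ) ≡ true → ν ≢ κ → rank κ < rank ν

module _ {n} {K : SimplicialComplex n} (W : MorseSequence K)
  (Mate : Subset n → Subset n → Set) (link : Subset n → Subset n → Bool) where

  -- Common form of the reference and coreference conditions. The equation of a pair is indexed by
  -- the simplex solved for, not by its mate, so that the chain lives in dimension `p` itself rather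
  -- than in `p - 1ℤ` or `p + 1ℤ`.
  record IsSolution (Υ : Frame W) : Set where
    open Frame Υ
    field
      onCritical : ∀ {p} (ν : Simplex K p) → IsCritical W (vertices ν) →
                   onSimplex ν ≗ singleton ν
      onTarget   : ∀ {p} (ν : Simplex K p) → ∃ (λ μ → Mate μ (vertices ν)) →
                   onSimplex ν ≗ 0ᶜ
      onLink     : ∀ {p} (ν : Simplex K p) {μ} → Mate (vertices ν) μ →
                   onChain {p} (λ κ → link μ (vertices κ)) ≗ 0ᶜ

module Solve {n} {K : SimplicialComplex n} {W : MorseSequence K}
  {Mate : Subset n → Subset n → Set} {link : Subset n → Subset n → Bool}
  (matching : IsAcyclicMatching W Mate link) where
  open IsAcyclicMatching matching

  Status : Subset n → Set
  Status ν = IsCritical W ν ⊎ ∃ (λ μ → Mate μ ν) ⊎ ∃ (Mate ν)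

  module _ {p : ℤ} where

    linkTerm : Subset n → (Simplex K p → Bool) → Simplex K p → Bool
    linkTerm μ g κ = link μ (vertices κ) ∧ g κ

    linkSum : Subset n → (Simplex K p → Bool) → Bool
    linkSum μ g = ⨁ (linkTerm μ g) (simplices K p)

    linkSumWithout : Simplex K p → Subset n → (Simplex K p → Bool) → Bool
    linkSumWithout ν μ g = ⨁ (omit ν (linkTerm μ g)) (simplices K p)

    -- By `linked`, the unknown `g ν` occurs in its own equation with coefficient 1.
    linkSum-isolate : ∀ ν {μ} → Mate (vertices ν) μ → ∀ g →
                      linkSum μ g ≡ g ν xor linkSumWithout ν μ g
    linkSum-isolate ν {μ} m g =
      trans (⨁-isolate (omit-≢ ν (linkTerm μ g)) (omit-self ν (linkTerm μ g))
                       (simplices-unique K p) (simplices-complete K p ν))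
            (cong (λ b → (b ∧ g ν) xor linkSumWithout ν μ g) (linked m))

  -- Component at κ of the value at ν, given the components g of the other values.
  update : ∀ {p} → Simplex K p → (Simplex K p → Bool) → ∀ ν → Status (vertices ν) → Bool
  update κ g ν (inj₁ _)              = singleton ν κ
  update κ g ν (inj₂ (inj₁ _))       = false
  update κ g ν (inj₂ (inj₂ (μ , _))) = linkSumWithout ν μ g

  -- Only the last status reads `g`. There the term at `ν` is omitted, terms outside the link
  -- vanish, and all others have smaller rank by `decreasing`.
  update-contractive : ∀ {p} (κ : Simplex K p) {g h} ν (st : Status (vertices ν)) →
    (∀ ρ → rank ρ < rank ν → g ρ ≡ h ρ) → update κ g ν st ≡ update κ h ν st
  update-contractive κ         ν (inj₁ _)              _   = refl
  update-contractive κ         ν (inj₂ (inj₁ _))       _   = refl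
  update-contractive κ {g} {h} ν (inj₂ (inj₂ (μ , m))) g≡h = ⨁-cong agree (simplices _ _)
    where
    agree : ∀ ρ → omit ν (linkTerm μ g) ρ ≡ omit ν (linkTerm μ h) ρ
    agree ρ with vertices ρ ≟ˢ vertices ν | link μ (vertices ρ) in linkρ
    ... | yes _ | _     = refl
    ... | no _  | false = refl
    ... | no ρ≢ν | true = g≡h ρ (decreasing ν ρ m linkρ (ρ≢ν ∘ cong vertices ∘ sym))

  statusOf : ∀ {p} (ν : Simplex K p) → Status (vertices ν)
  statusOf ν = status (isFace ν)

  -- Chains are added pointwise, so the equations for a frame decouple into one Boolean fixed point
  -- problem for each `κ`.
  module Component {p} (κ : Simplex K p) =
    Contraction false rank (λ g ν → update κ g ν (statusOf ν)) (λ ν → update-contractive κ ν (statusOf ν))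

  -- Iteration starts at `false`, so a `true` component at `κ` can be traced back through linked
  -- simplices until it arises from `singleton` at a critical simplex, which is then `κ`.
  iterate-critical : ∀ {p} (κ : Simplex K p) k ν → Component.iterate κ k ν ≡ true → IsCritical W (vertices κ)
  iterate-critical κ (suc k) ν = case (statusOf ν)
    where
    case : ∀ st → update κ (Component.iterate κ k) ν st ≡ true → IsCritical W (vertices κ)
    case (inj₁ crit) eq with vertices κ ≟ˢ vertices ν
    ... | yes κ≡ν = subst (IsCritical W) (sym κ≡ν) crit
    case (inj₂ (inj₂ (μ , _))) eq with ⨁-true _ (simplices _ _) eq
    -- The summand is a conjunction; for every other pair of values it is `false`, which contradicts
    -- `eq′`.
    ... | ρ , eq′ with singleton ν ρ | link μ (vertices ρ)
    ...   | false | true = iterate-critical κ k ρ eq′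

  solution : Frame W
  solution = record { value = λ ν → record
    { chain    = λ κ → Component.fix κ ν
    ; critical = λ κ → iterate-critical κ (suc (rank ν)) ν
    } }

  solution-isSolution : IsSolution W Mate link solution
  solution-isSolution = record
    { onCritical = λ ν crit κ → trans (Component.fix-eq κ ν) (critical-case κ ν crit (statusOf ν))
    ; onTarget   = λ ν t κ → trans (Component.fix-eq κ ν) (target-case κ ν t (statusOf ν))
    ; onLink     = λ {p} ν {μ} m κ → begin
        Frame.onChain solution {p} (λ ρ → link μ (vertices ρ)) κ
          ≡⟨ foldr-⊕ (Frame.onSimplex solution) _ (simplices K p) κ ⟩
        linkSum μ (Component.fix κ)
          ≡⟨ linkSum-isolate ν m (Component.fix κ) ⟩
        Component.fix κ ν xor linkSumWithout ν μ (Component.fix κ)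
          -- The fixed point equation makes the value at `ν` equal to the rest of the sum, and the
          -- two cancel mod 2.
          ≡⟨ cong (_xor linkSumWithout ν μ (Component.fix κ))
               (trans (Component.fix-eq κ ν) (source-case κ ν m (statusOf ν))) ⟩
        linkSumWithout ν μ (Component.fix κ) xor linkSumWithout ν μ (Component.fix κ)
          ≡⟨ xor-same (linkSumWithout ν μ (Component.fix κ)) ⟩
        false ∎
    }
    where
    open ≡-Reasoning

    -- `update` branches on the status that `statusOf` happens to return. The three statuses exclude
    -- each other, so the hypothesis on `ν` selects the branch; hence the quantification over all
    -- `st` here and in the next two cases.
    critical-case : ∀ {p} (κ : Simplex K p) {g} ν → IsCritical W (vertices ν) →
      ∀ st → update κ g ν st ≡ singleton ν κ
    critical-case κ ν crit (inj₁ _)              = refl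
    critical-case κ ν crit (inj₂ (inj₁ (_ , m))) = contradiction m (critical-target crit)
    critical-case κ ν crit (inj₂ (inj₂ (_ , m))) = contradiction m (critical-source crit)

    target-case : ∀ {p} (κ : Simplex K p) {g} ν → ∃ (λ μ → Mate μ (vertices ν)) →
      ∀ st → update κ g ν st ≡ false
    target-case κ ν (_ , m) (inj₁ crit)            = contradiction m (critical-target crit)
    target-case κ ν _       (inj₂ (inj₁ _))        = refl
    target-case κ ν (_ , m) (inj₂ (inj₂ (_ , m′))) = contradiction m (source-target m′)

    source-case : ∀ {p} (κ : Simplex K p) {g} ν {μ} → Mate (vertices ν) μ →
      ∀ st → update κ g ν st ≡ linkSumWithout ν μ g
    source-case κ ν m (inj₁ crit)            = contradiction m (critical-source crit)
    source-case κ ν m (inj₂ (inj₁ (_ , m′))) = contradiction m′ (source-target m)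
    -- The returned status carries its own mate, which `functional` identifies with `μ`.
    source-case κ {g} ν m (inj₂ (inj₂ (_ , m′))) = cong (λ μ → linkSumWithout ν μ g) (functional m′ m)

  -- Mod 2, a vanishing link sum can be solved for its term at `ν`, so every component of a solution
  -- is a fixed point of `update`.
  component-eq : ∀ {Υ} → IsSolution W Mate link Υ → ∀ {p} (κ ν : Simplex K p) →
                 let g = λ ρ → Frame.onSimplex Υ ρ κ in g ν ≡ update κ g ν (statusOf ν)
  component-eq {Υ} isSol κ ν with statusOf ν
  ... | inj₁ crit           = IsSolution.onCritical isSol ν crit κ
  ... | inj₂ (inj₁ t)       = IsSolution.onTarget isSol ν t κ
  ... | inj₂ (inj₂ (μ , m)) = xor-false⇒≡ _ _ (begin
    g ν xor linkSumWithout ν μ g                  ≡⟨ linkSum-isolate ν m g ⟨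
    linkSum μ g                                   ≡⟨ foldr-⊕ (Frame.onSimplex Υ) _ (simplices K _) κ ⟨
    Frame.onChain Υ (λ ρ → link μ (vertices ρ)) κ ≡⟨ IsSolution.onLink isSol ν m κ ⟩
    false                                         ∎)
    where
    open ≡-Reasoning
    g : Simplex K _ → Bool
    g ρ = Frame.onSimplex Υ ρ κ

  solution-unique : ∀ {Υ} → IsSolution W Mate link Υ → solution ≈ᶠ Υ
  solution-unique isSol ν κ =
    Component.fix-unique κ (Component.fix-eq κ) (component-eq isSol κ) ν

does-true⇒ : ∀ {A : Set} (a? : Dec A) → does a? ≡ true → A
does-true⇒ (yes a) _ = a

-- Births in a Morse sequence

∣p∪⁅x⁆∣≡1+∣p∣ : ∀ {n} (p : Subset n) {x} → x ∉ˢ p → ∣ p ∪ˢ ⁅ x ⁆ ∣ ≡ suc ∣ p ∣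
∣p∪⁅x⁆∣≡1+∣p∣ (inside  ∷ p) {zero}  x∉p = contradiction hereᵛ x∉p
∣p∪⁅x⁆∣≡1+∣p∣ (outside ∷ p) {zero}  x∉p = cong (suc ∘ ∣_∣) (∪-identityʳ p)
∣p∪⁅x⁆∣≡1+∣p∣ (inside  ∷ p) {suc x} x∉p = cong suc (∣p∪⁅x⁆∣≡1+∣p∣ p (x∉p ∘ thereᵛ))
∣p∪⁅x⁆∣≡1+∣p∣ (outside ∷ p) {suc x} x∉p = ∣p∪⁅x⁆∣≡1+∣p∣ p (x∉p ∘ thereᵛ)

⊂⇒≢ : ∀ {n} {p q : Subset n} → p ⊂ q → p ≢ q
⊂⇒≢ p⊂q p≡q = ⊂-irref p≡q p⊂q

module _ {n} (L : SimplicialComplex n) {σ τ : Subset n} where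
  open SimplicialComplex L using (closed)

  -- Adding to `σ` one vertex `x` of `τ` outside it gives a face between the two, by closure. It
  -- differs from `σ`, so freeness forces it to be `τ`.
  freePair-card : IsFreePair L σ τ → ∣ τ ∣ ≡ suc ∣ σ ∣
  freePair-card (_ , τ∈L , (σ⊆τ , x , x∈τ , x∉σ) , only) =
    trans (cong ∣_∣ (sym ρ≡τ)) (∣p∪⁅x⁆∣≡1+∣p∣ σ x∉σ)
    where
    ρ : Subset n
    ρ = σ ∪ˢ ⁅ x ⁆
    x∈ρ : x ∈ˢ ρ
    x∈ρ = q⊆p∪q σ ⁅ x ⁆ (x∈⁅x⁆ x)
    ρ⊆τ : ρ ⊆ τ
    ρ⊆τ y∈ρ with x∈p∪q⁻ σ ⁅ x ⁆ y∈ρ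
    ... | inj₁ y∈σ = σ⊆τ y∈σ
    ... | inj₂ y∈x = subst (_∈ˢ τ) (sym (x∈⁅y⁆⇒x≡y x y∈x)) x∈τ
    ρ≡τ : ρ ≡ τ
    ρ≡τ = only (closed τ∈L ρ⊆τ (x , x∈ρ)) (λ ρ≡σ → x∉σ (subst (x ∈ˢ_) ρ≡σ x∈ρ)) (p⊆p∪q ⁅ x ⁆)

  freePair-dim-pred : IsFreePair L σ τ → dim τ - 1ℤ ≡ dim σ
  -- `+ suc k - 1ℤ` computes to `+ k`, so the right-hand side is already `dim σ`.
  freePair-dim-pred free = cong (λ k → + k - 1ℤ - 1ℤ) (freePair-card free)

  freePair-dim-suc : IsFreePair L σ τ → dim σ + 1ℤ ≡ dim τ
  freePair-dim-suc free = trans (cong (_+ 1ℤ) (sym (freePair-dim-pred free))) (p-1+1≡p (dim τ))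
    where
    p-1+1≡p : ∀ p → p - 1ℤ + 1ℤ ≡ p
    p-1+1≡p p = trans (+-assoc p (- 1ℤ) 1ℤ) (+-identityʳ p)

module Births {n} {K : SimplicialComplex n} (W : MorseSequence K) where
  open MorseSequence W

  Born : Fin length → Subset n → Set
  Born i ρ = ρ ∈ faces (complex (suc i)) × ρ ∉ faces (complex (inject₁ i))

  module _ {i σ τ} (exp : IsExpansionBy (complex (inject₁ i)) (complex (suc i)) σ τ) where

    expansion-⊂ : σ ⊂ τ
    expansion-⊂ = proj₁ (proj₂ (proj₂ (proj₁ exp)))

    expansion-born₁ : Born i σ
    expansion-born₁ = proj₁ (proj₁ exp) , λ σ∈L → proj₂ (proj₁ (proj₂ exp) σ∈L) (inj₁ refl)

    expansion-born₂ : Born i τ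
    expansion-born₂ = proj₁ (proj₂ (proj₁ exp)) , λ τ∈L → proj₂ (proj₁ (proj₂ exp) τ∈L) (inj₂ refl)

    expansion-old : ∀ {ρ} → ρ ∈ faces (complex (suc i)) → σ ≢ ρ → τ ≢ ρ → ρ ∈ faces (complex (inject₁ i))
    expansion-old ρ∈ σ≢ρ τ≢ρ = proj₂ (proj₂ exp) (ρ∈ , λ { (inj₁ eq) → σ≢ρ eq ; (inj₂ eq) → τ≢ρ eq })

    born-expansion : ∀ {ρ} → Born i ρ → σ ≡ ρ ⊎ τ ≡ ρ
    born-expansion {ρ} (ρ∈ , ρ∉) with σ ≟ˢ ρ | τ ≟ˢ ρ
    ... | yes σ≡ρ | _       = inj₁ σ≡ρ
    ... | no _    | yes τ≡ρ = inj₂ τ≡ρ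
    ... | no σ≢ρ  | no τ≢ρ  = contradiction (expansion-old ρ∈ σ≢ρ τ≢ρ) ρ∉

  module _ {i ν} (fill : IsFillingBy (complex (inject₁ i)) (complex (suc i)) ν) where

    filling-born : Born i ν
    filling-born = proj₁ (proj₁ fill) , λ ν∈L → proj₂ (proj₁ (proj₂ fill) ν∈L) refl

    born-filling : ∀ {ρ} → Born i ρ → ν ≡ ρ
    born-filling {ρ} (ρ∈ , ρ∉) with ν ≟ˢ ρ
    ... | yes ν≡ρ = ν≡ρ
    ... | no  ν≢ρ = contradiction (proj₂ (proj₂ fill) (ρ∈ , ν≢ρ)) ρ∉

  grow : ∀ i {ρ} → ρ ∈ faces (complex (inject₁ i)) → ρ ∈ faces (complex (suc i))
  grow i ρ∈ with step i
  ... | inj₁ (_ , _ , _ , L≐) = proj₁ (proj₁ L≐ ρ∈)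
  ... | inj₂ (_ , _ , L≐)     = proj₁ (proj₁ L≐ ρ∈)

  mono : ∀ {i j ρ} → i Fin.≤ j → ρ ∈ faces (complex i) → ρ ∈ faces (complex j)
  mono {ρ = ρ} i≤j ρ∈ = <-weakInduction-startingFrom (λ j → ρ ∈ faces (complex j)) ρ∈ (λ i → grow i) i≤j

  -- Otherwise `ρ` would persist into the complex from which step `j` starts, and would not be new
  -- there.
  birth-before : ∀ {i j ρ} → Born j ρ → ρ ∈ faces (complex (inject₁ i)) → j Fin.< i
  birth-before {i} {j} (_ , ρ∉) ρ∈ with toℕ j ℕ.<? toℕ i
  ... | yes j<i = j<i
  ... | no  j≮i = contradiction (mono inj-i≤inj-j ρ∈) ρ∉
    where
    inj-i≤inj-j : inject₁ i Fin.≤ inject₁ j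
    inj-i≤inj-j rewrite toℕ-inject₁ i | toℕ-inject₁ j = ℕ.≮⇒≥ j≮i

  birth-after : ∀ {i j ρ} → Born j ρ → ρ ∉ faces (complex (suc i)) → i Fin.< j
  birth-after {i} {j} (ρ∈ , _) ρ∉ with toℕ i ℕ.<? toℕ j
  ... | yes i<j = i<j
  ... | no  i≮j = contradiction (mono (s≤s (ℕ.≮⇒≥ i≮j)) ρ∈) ρ∉

  suc≤inject₁ : ∀ {i j : Fin length} → i Fin.< j → suc i Fin.≤ inject₁ j
  suc≤inject₁ {i} {j} = subst (suc (toℕ i) ≤_) (sym (toℕ-inject₁ j))

  born-unique : ∀ {i j ρ} → Born i ρ → Born j ρ → i ≡ j
  born-unique {i} {j} bᵢ bⱼ with <-cmp i j
  ... | tri≈ _ i≡j _ = i≡j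
  ... | tri< i<j _ _ = contradiction (mono (suc≤inject₁ i<j) (proj₁ bᵢ)) (proj₂ bⱼ)
  ... | tri> _ _ j<i = contradiction (mono (suc≤inject₁ j<i) (proj₁ bⱼ)) (proj₂ bᵢ)

  -- Decidable membership allows a search backwards from the last complex for the step at which `ρ`
  -- enters; it succeeds because the first complex is empty.
  birth : ∀ {ρ} → ρ ∈ faces K → ∃ λ i → Born i ρ
  birth {ρ} ρ∈K = <-weakInduction (λ i → ρ ∈ faces (complex i) → ∃ λ j → Born j ρ)
    (λ ρ∈ → contradiction (proj₁ start ρ∈) λ ()) extend (fromℕ length) (proj₂ end ρ∈K)
    where
    extend : ∀ i → (ρ ∈ faces (complex (inject₁ i)) → ∃ λ j → Born j ρ) →
             ρ ∈ faces (complex (suc i)) → ∃ λ j → Born j ρ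
    extend i earlier ρ∈ with SimplicialComplex._∈?faces (complex (inject₁ i)) ρ
    ... | yes ρ∈L = earlier ρ∈L
    ... | no  ρ∉L = i , ρ∈ , ρ∉L

  status : ∀ {ρ} → ρ ∈ faces K → IsCritical W ρ ⊎ IsUpperRegular W ρ ⊎ IsLowerRegular W ρ
  status ρ∈K with birth ρ∈K
  ... | i , b with step i
  ...   | inj₂ (ν , fill) with born-filling fill b
  ...     | refl = inj₁ (i , fill)
  status ρ∈K | i , b | inj₁ (σ , τ , exp) with born-expansion exp b
  ...     | inj₁ refl = inj₂ (inj₂ (τ , i , exp))
  ...     | inj₂ refl = inj₂ (inj₁ (σ , i , exp))

  -- Uniqueness of births makes the two steps coincide, but a filling adds one simplex and an
  -- expansion two distinct ones. The same holds for `critical-upper`.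
  critical-lower : ∀ {ν τ} → IsCritical W ν → ¬ IsRegularPair W ν τ
  critical-lower (i , fill) (j , exp) with born-unique (filling-born fill) (expansion-born₁ exp)
  ... | refl = ⊂⇒≢ (expansion-⊂ exp) (born-filling fill (expansion-born₂ exp))

  critical-upper : ∀ {ν σ} → IsCritical W ν → ¬ IsRegularPair W σ ν
  critical-upper (i , fill) (j , exp) with born-unique (filling-born fill) (expansion-born₂ exp)
  ... | refl = ⊂⇒≢ (expansion-⊂ exp) (sym (born-filling fill (expansion-born₁ exp)))

  -- Both pairs arise at the same step, so `σ` is `ν` or `τ`. Neither is possible, since `σ` lies
  -- strictly inside `ν`, which lies strictly inside `τ`.
  lower-upper : ∀ {ν τ σ} → IsRegularPair W ν τ → ¬ IsRegularPair W σ ν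
  lower-upper (i , exp) (j , exp′) with born-unique (expansion-born₁ exp) (expansion-born₂ exp′)
  ... | refl with born-expansion exp (expansion-born₁ exp′)
  ...   | inj₁ ν≡σ = ⊂⇒≢ (expansion-⊂ exp′) (sym ν≡σ)
  ...   | inj₂ refl = ⊂-asymmetric (expansion-⊂ exp) (expansion-⊂ exp′)

  lower-functional : ∀ {σ τ τ′} → IsRegularPair W σ τ → IsRegularPair W σ τ′ → τ ≡ τ′
  lower-functional (i , exp) (j , exp′) with born-unique (expansion-born₁ exp) (expansion-born₁ exp′)
  ... | refl with born-expansion exp (expansion-born₂ exp′)
  ...   | inj₁ σ≡τ′ = contradiction σ≡τ′ (⊂⇒≢ (expansion-⊂ exp′))
  ...   | inj₂ τ≡τ′ = τ≡τ′

  upper-functional : ∀ {σ σ′ τ} → IsRegularPair W σ τ → IsRegularPair W σ′ τ → σ ≡ σ′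
  upper-functional (i , exp) (j , exp′) with born-unique (expansion-born₂ exp) (expansion-born₂ exp′)
  ... | refl with born-expansion exp (expansion-born₁ exp′)
  ...   | inj₁ σ≡σ′ = σ≡σ′
  ...   | inj₂ τ≡σ′ = contradiction (sym τ≡σ′) (⊂⇒≢ (expansion-⊂ exp′))

  index : ∀ {p} → Simplex K p → Fin length
  index ν = proj₁ (birth (isFace ν))

  index-born : ∀ {p} (ν : Simplex K p) → Born (index ν) (vertices ν)
  index-born ν = proj₂ (birth (isFace ν))

  boundary-decreasing : ∀ {p} (ν κ : Simplex K p) {τ} → IsRegularPair W (vertices ν) τ →
                        vertices κ ⊂ τ → ν ≢ κ → index κ Fin.< index ν
  boundary-decreasing ν κ (i , exp) κ⊂τ ν≢κ
    -- The step found by `birth` is thereby identified with the step `i` that adds the pair.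
    rewrite born-unique (index-born ν) (expansion-born₁ exp) =
    birth-before (index-born κ) (expansion-old exp
      (SimplicialComplex.closed (complex (suc i)) (proj₁ (expansion-born₂ exp)) (proj₁ κ⊂τ)
        (SimplicialComplex.nonempty K (isFace κ)))
      (ν≢κ ∘ vertices-injective) (⊂⇒≢ κ⊂τ ∘ sym))

  coboundary-increasing : ∀ {p} (ν κ : Simplex K p) {σ} → IsRegularPair W σ (vertices ν) →
                          σ ⊂ vertices κ → ν ≢ κ → index ν Fin.< index κ
  coboundary-increasing ν κ (i , exp) σ⊂κ ν≢κ
    rewrite born-unique (index-born ν) (expansion-born₂ exp) =
    birth-after (index-born κ) λ κ∈ → ν≢κ (sym (vertices-injective
      (proj₂ (proj₂ (proj₂ (proj₁ exp))) κ∈ (⊂⇒≢ σ⊂κ ∘ sym) (proj₁ σ⊂κ))))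

  face-K : ∀ {i ρ} → ρ ∈ faces (complex i) → ρ ∈ faces K
  face-K {i} ρ∈ = proj₁ end (mono (≤fromℕ i) ρ∈)

-- Reference maps: boundary equations solved in order of birth

module Reference {n} {K : SimplicialComplex n} (W : MorseSequence K) where
  open MorseSequence W using (complex)
  open Births W

  boundaryLink : Subset n → Subset n → Bool
  boundaryLink τ ν = does (ν ⊂? τ)

  matching : IsAcyclicMatching W (IsRegularPair W) boundaryLink
  matching = record
    { status          = status
    ; critical-source = critical-lower
    ; critical-target = critical-upper
    ; source-target   = lower-upper
    ; functional      = lower-functional
    ; linked          = λ { (_ , exp) → dec-true (_ ⊂? _) (expansion-⊂ exp) }
    ; rank            = toℕ ∘ index
    ; decreasing      = λ ν κ m κ⊂τ → boundary-decreasing ν κ m (does-true⇒ (_ ⊂? _) κ⊂τ)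
    }

  isReferenceMap : ∀ {Υ} → IsSolution W (IsRegularPair W) boundaryLink Υ → IsReferenceMap W Υ
  isReferenceMap sol = record
    { onCritical = onCritical
    ; onUpper    = onTarget
    -- The boundary condition at `τ` is the equation of its partner `σ`, once `σ` is known to have
    -- dimension one less.
    ; onBoundary = λ { τ (σ , i , exp) → onLink
        (simplex σ (face-K (proj₁ (expansion-born₁ exp)))
          (trans (sym (freePair-dim-pred (complex (suc i)) (proj₁ exp))) (cong (_- 1ℤ) (hasDim τ))))
        (i , exp) }
    }
    where open IsSolution sol

  isSolution : ∀ {Υ} → IsReferenceMap W Υ → IsSolution W (IsRegularPair W) boundaryLink Υ
  isSolution {Υ} ref = record
    { onCritical = onCritical
    ; onTarget   = onUpper
    ; onLink     = λ { σ (i , exp) → onLink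
        (face-K (proj₁ (expansion-born₂ exp))) (vertices σ , i , exp)
        (trans (freePair-dim-pred (complex (suc i)) (proj₁ exp)) (hasDim σ)) }
    }
    where
    open IsReferenceMap ref
    -- Keeping `p` general and matching the dimension equation with `refl` avoids transporting
    -- chains between equal dimensions.
    onLink : ∀ {p τ} → τ ∈ faces K → IsUpperRegular W τ → dim τ - 1ℤ ≡ p →
             Frame.onChain Υ {p} (λ ν → boundaryLink τ (vertices ν)) ≗ 0ᶜ
    onLink {τ = τ} τ∈K upper refl = onBoundary (simplex τ τ∈K refl) upper

-- Coreference maps: coboundary equations solved in reverse order of birth

module Coreference {n} {K : SimplicialComplex n} (W : MorseSequence K) where
  open MorseSequence W using (length; complex)
  open Births W

  coboundaryLink : Subset n → Subset n → Bool
  coboundaryLink σ ν = does (σ ⊂? ν)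

  CoregularPair : Subset n → Subset n → Set
  CoregularPair τ σ = IsRegularPair W σ τ

  matching : IsAcyclicMatching W CoregularPair coboundaryLink
  matching = record
    { status          = map₂ swap ∘ status
    ; critical-source = critical-upper
    ; critical-target = critical-lower
    ; source-target   = λ m m′ → lower-upper m′ m
    ; functional      = upper-functional
    ; linked          = λ { (_ , exp) → dec-true (_ ⊂? _) (expansion-⊂ exp) }
    -- Counting from the end turns later births into smaller ranks. Truncated subtraction is
    -- strictly decreasing here because every index is below `length`.
    ; rank            = λ ν → length ∸ toℕ (index ν)
    ; decreasing      = λ ν κ m σ⊂κ ν≢κ → ℕ.∸-monoʳ-<
        (coboundary-increasing ν κ m (does-true⇒ (_ ⊂? _) σ⊂κ) ν≢κ) (ℕ.<⇒≤ (toℕ<n (index κ)))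
    }

  isCoreferenceMap : ∀ {Υ} → IsSolution W CoregularPair coboundaryLink Υ → IsCoreferenceMap W Υ
  isCoreferenceMap sol = record
    { onCritical   = onCritical
    ; onLower      = onTarget
    ; onCoboundary = λ { σ (τ , i , exp) → onLink
        (simplex τ (face-K (proj₁ (expansion-born₂ exp)))
          (trans (sym (freePair-dim-suc (complex (suc i)) (proj₁ exp))) (cong (_+ 1ℤ) (hasDim σ))))
        (i , exp) }
    }
    where open IsSolution sol

  isSolution : ∀ {Υ} → IsCoreferenceMap W Υ → IsSolution W CoregularPair coboundaryLink Υ
  isSolution {Υ} coref = record
    { onCritical = onCritical
    ; onTarget   = onLower
    ; onLink     = λ { τ (i , exp) → onLink
        (face-K (proj₁ (expansion-born₁ exp))) (vertices τ , i , exp)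
        (trans (freePair-dim-suc (complex (suc i)) (proj₁ exp)) (hasDim τ)) }
    }
    where
    open IsCoreferenceMap coref
    onLink : ∀ {p σ} → σ ∈ faces K → IsLowerRegular W σ → dim σ + 1ℤ ≡ p →
             Frame.onChain Υ {p} (λ ν → coboundaryLink σ (vertices ν)) ≗ 0ᶜ
    onLink {σ = σ} σ∈K lower refl = onCoboundary (simplex σ σ∈K refl) lower

-- Existence and uniqueness of both maps

theorem1 : ∀ (n : ℕ) (K : SimplicialComplex n) (W : MorseSequence K) →
    ∃! _≈ᶠ_ (IsReferenceMap W) × ∃! _≈ᶠ_ (IsCoreferenceMap W)
theorem1 n K W =
  (R.solution , Reference.isReferenceMap W R.solution-isSolution ,
    λ ref → R.solution-unique (Reference.isSolution W ref)) ,
  (C.solution , Coreference.isCoreferenceMap W C.solution-isSolution ,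
    λ coref → C.solution-unique (Coreference.isSolution W coref))
  where
  module R = Solve (Reference.matching W)
  module C = Solve (Coreference.matching W)
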